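{- For all $n\ge 1$, any hazard-free De Morgan formula for $\mathsf{MUX}_n$ has at least $2\cdot3^n-1$ leaves.
   Context: $\mathsf{MUX}_n\colon\{0,1\}^{n+2^n}\to\{0,1\}$ is $\mathsf{MUX}_n(s_1,\dots,s_n,x_0,\dots,x_{2^n-1})=x_{\mathrm{bin}(s_1,\dots,s_n)}$, where $\mathrm{bin}(s_1,\dots,s_n)$ is the natural number with binary representation $s_1s_2\cdots s_n$. Three-valued logic: let $\mathsf u$ be a third symbol, thought of as $\tfrac12$, so $0<\mathsf u<1$; $x\wedge y=\min(x,y)$, $x\vee y=\max(x,y)$, $\neg x=1-x$ on $\{0,\mathsf u,1\}$. A resolution of $\alpha\in\{0,\mathsf u,1\}^m$ is a string $a\in\{0,1\}^m$ with $a_i=\alpha_i$ whenever $\alpha_i\ne\mathsf u$. The hazard-free extension $\tilde f$ of $f\colon\{0,1\}^m\to\{0,1\}$ is: $\tilde f(\alpha)=c\in\{0,1\}$ if $f(a)=c$ for all resolutions $a$ of $\alpha$, and $\tilde f(\alpha)=\mathsf u$ otherwise. A De Morgan formula is a binary tree whose internal nodes are labeled $\vee$ or $\wedge$ (fan-in two) and whose leaves are labeled by literals (a variable or its negation), evaluated on $\{0,\mathsf u,1\}$-inputs by the rules above. A formula $F$ computing $f$ is hazard-free if $F(\alpha)=\tilde f(\alpha)$ for all $\alpha\in\{0,\mathsf u,1\}^m$. -}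

module Defs where

open import Data.Bool.Base using (Bool; true; false; if_then_else_)
import Data.Bool.Properties as Bool
open import Data.Fin.Base using (Fin; zero; suc; combine; toℕ)
open import Data.Fin.Properties using (all?; toℕ-combine)
open import Data.Nat.Base using (ℕ; zero; suc; _+_; _*_; _^_)
open import Data.Vec.Base using (Vec; []; _∷_; lookup; map; take; drop)
open import Relation.Binary.Definitions using (DecidableEquality)
open import Relation.Binary.PropositionalEquality using (_≡_; _≢_; refl)
open import Relation.Nullary.Decidable using (Dec; yes; no; does; map′; _×-dec_; _→-dec_; ¬?)
open import Data.Product.Base using (_×_; _,_)

private
  variable
    m n : ℕ

bit : Bool → Fin 2
bit false = zero
bit true  = suc zero

-- The head s₁ is the most significant bit: combine {2} {k} i j has value k * i + j.
bin : Vec Bool n → Fin (2 ^ n)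
bin []      = zero
bin (b ∷ s) = combine (bit b) (bin s)

toℕ-bin-∷ : ∀ (b : Bool) (s : Vec Bool n) →
            toℕ (bin (b ∷ s)) ≡ 2 ^ n * toℕ (bit b) + toℕ (bin s)
toℕ-bin-∷ b s = toℕ-combine (bit b) (bin s)

MUX : ∀ n → Vec Bool (n + 2 ^ n) → Bool
MUX n v = lookup (drop n v) (bin (take n v))

data Three : Set where
  𝟎 𝐮 𝟏 : Three

infixr 6 _⊓_
infixr 5 _⊔_

-- Minimum and maximum for the order 𝟎 < 𝐮 < 𝟏.
_⊓_ : Three → Three → Three
𝟎 ⊓ _ = 𝟎
𝐮 ⊓ 𝟎 = 𝟎
𝐮 ⊓ 𝐮 = 𝐮
𝐮 ⊓ 𝟏 = 𝐮
𝟏 ⊓ y = y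

_⊔_ : Three → Three → Three
𝟎 ⊔ y = y
𝐮 ⊔ 𝟎 = 𝐮
𝐮 ⊔ 𝐮 = 𝐮
𝐮 ⊔ 𝟏 = 𝟏
𝟏 ⊔ _ = 𝟏

-- x ↦ 1 - x, with 𝐮 read as 1/2.
∼_ : Three → Three
∼ 𝟎 = 𝟏
∼ 𝐮 = 𝐮
∼ 𝟏 = 𝟎

embed : Bool → Three
embed false = 𝟎
embed true  = 𝟏

_≟_ : DecidableEquality Three
𝟎 ≟ 𝟎 = yes refl
𝟎 ≟ 𝐮 = no λ ()
𝟎 ≟ 𝟏 = no λ ()
𝐮 ≟ 𝟎 = no λ ()
𝐮 ≟ 𝐮 = yes refl
𝐮 ≟ 𝟏 = no λ ()
𝟏 ≟ 𝟎 = no λ ()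
𝟏 ≟ 𝐮 = no λ ()
𝟏 ≟ 𝟏 = yes refl

IsResolution : Vec Three m → Vec Bool m → Set
IsResolution α a = ∀ i → lookup α i ≢ 𝐮 → embed (lookup a i) ≡ lookup α i

isResolution? : ∀ (α : Vec Three m) a → Dec (IsResolution α a)
isResolution? α a =
  all? λ i → ¬? (lookup α i ≟ 𝐮) →-dec (embed (lookup a i) ≟ lookup α i)

ConstantOnResolutions : (Vec Bool m → Bool) → Vec Three m → Bool → Set
ConstantOnResolutions f α c = ∀ a → IsResolution α a → f a ≡ c

allVec? : {P : Vec Bool m → Set} → (∀ a → Dec (P a)) → Dec (∀ a → P a)
allVec? {zero}  P? = map′ (λ { p [] → p }) (λ h → h []) (P? [])
allVec? {suc m} P? =
  map′ (λ { (p , q) (false ∷ a) → p a ; (p , q) (true ∷ a) → q a })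
       (λ h → (λ a → h (false ∷ a)) , (λ a → h (true ∷ a)))
       (allVec? (λ a → P? (false ∷ a)) ×-dec allVec? (λ a → P? (true ∷ a)))

constantOnResolutions? : ∀ (f : Vec Bool m → Bool) α c →
                         Dec (ConstantOnResolutions f α c)
constantOnResolutions? f α c =
  allVec? λ a → isResolution? α a →-dec (f a Bool.≟ c)

-- Every α has a resolution, so at most one of the two tests succeeds and
-- their order is immaterial.
hazardFreeExtension : (Vec Bool m → Bool) → Vec Three m → Three
hazardFreeExtension f α =
  if does (constantOnResolutions? f α false) then 𝟎
  else if does (constantOnResolutions? f α true) then 𝟏
  else 𝐮

data Literal (m : ℕ) : Set where
  pos neg : Fin m → Literal m

data Formula (m : ℕ) : Set where
  leaf    : Literal m → Formula m
  _∧_ _∨_ : Formula m → Formula m → Formula m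

infixr 6 _∧_
infixr 5 _∨_

leaves : Formula m → ℕ
leaves (leaf _) = 1
leaves (F ∧ G)  = leaves F + leaves G
leaves (F ∨ G)  = leaves F + leaves G

evalLiteral : Literal m → Vec Three m → Three
evalLiteral (pos i) α = lookup α i
evalLiteral (neg i) α = ∼ lookup α i

eval : Formula m → Vec Three m → Three
eval (leaf l) α = evalLiteral l α
eval (F ∧ G)  α = eval F α ⊓ eval G α
eval (F ∨ G)  α = eval F α ⊔ eval G α

Computes : Formula m → (Vec Bool m → Bool) → Set
Computes F f = ∀ a → eval F (map embed a) ≡ embed (f a)

IsHazardFreeFor : Formula m → (Vec Bool m → Bool) → Set
IsHazardFreeFor F f = Computes F f × (∀ α → eval F α ≡ hazardFreeExtension f α)

{-# OPTIONS --safe #-}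

-- For ternary strings s and t, viewed as subcubes of selector values, let the
-- input minterm s select s and carry 1 in the cells of s and 𝐮 elsewhere, and
-- let maxterm t select t and carry 0 in the cells of t and 𝐮 elsewhere.  A
-- hazard-free formula for MUX is 1 on every minterm and 0 on every maxterm.
-- A data literal can separate minterm s from maxterm t only if the cubes s and
-- t meet, a selector literal only if they are disjoint.  Following each pair
-- (s , t) down to a separating leaf cuts the incidence matrix M of "s and t
-- meet" into p rank-one matrices over GF(2), and its complement into q, where
-- p + q is the number of leaves.  M is the n-th tensor power of an
-- invertible 3 × 3 matrix, hence has full rank 3 ^ n; so 3 ^ n ≤ p, and, the
-- complement of M differing from M by the rank-one all-ones matrix,
-- 3 ^ n ≤ 1 + q.
module Submission where

open import Defs
open import Algebra.Bundles using (CommutativeRing)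
open import Algebra.Properties.CommutativeSemigroup using (interchange)
open import Data.Bool.Base using (Bool; true; false; not; if_then_else_)
  renaming (_∧_ to _·_; _xor_ to _⊕_)
open import Data.Bool.Properties
  using (xor-assoc; xor-identityʳ; ∧-assoc; ∧-identityʳ; ∧-zeroʳ; ∧-distribʳ-xor;
         not-involutive; xor-∧-commutativeRing)
open import Data.Bool.Solver using (module xor-∧-Solver)
open import Data.Fin.Base
  using (Fin; zero; suc; combine; splitAt; quotient; remainder; _↑ˡ_; _↑ʳ_)
open import Data.Fin.Properties
  using (remQuot-combine; combine-remQuot; injective⇒≤; splitAt⁻¹-↑ˡ; splitAt⁻¹-↑ʳ)
open import Data.Nat.Base using (ℕ; zero; suc; _+_; _*_; _^_; _∸_; _≤_)
open import Data.Nat.Properties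
  using (+-commutativeSemigroup; +-identityʳ; +-mono-≤; +-suc; ^-monoʳ-<; n<1+n; ≮⇒≥; <⇒≱;
         m≤n+o⇒m∸n≤o; module ≤-Reasoning)
open import Data.Product.Base using (Σ; ∃; _×_; _,_; proj₁; proj₂)
open import Data.Sum.Base using (_⊎_; inj₁; inj₂)
open import Data.Vec.Base using (Vec; []; _∷_; _++_; lookup; map; tabulate; take; drop)
open import Data.Vec.Properties
  using (lookup-++ˡ; lookup-++ʳ; lookup-map; lookup∘tabulate; tabulate∘lookup; tabulate-cong;
         take++drop≡id; ∷-injectiveˡ; ∷-injectiveʳ)
open import Relation.Binary.PropositionalEquality
  using (_≡_; _≢_; refl; sym; trans; cong; cong₂; subst; subst₂; module ≡-Reasoning)
open import Relation.Nullary.Decidable using (does; dec-true; dec-false)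
open import Relation.Nullary.Negation using (contradiction)
open xor-∧-Solver using (solve; con; _:+_; _:=_)

private
  variable
    X Y : Set
    k l m n : ℕ

⊕-interchange : ∀ a b c d → (a ⊕ b) ⊕ (c ⊕ d) ≡ (a ⊕ c) ⊕ (b ⊕ d)
⊕-interchange = interchange (CommutativeRing.+-commutativeSemigroup xor-∧-commutativeRing)

-- Bits of an index

unbit : Fin 2 → Bool
unbit zero    = false
unbit (suc _) = true

unbit∘bit : ∀ b → unbit (bit b) ≡ b
unbit∘bit false = refl
unbit∘bit true  = refl

bit∘unbit : ∀ i → bit (unbit i) ≡ i
bit∘unbit zero       = refl
bit∘unbit (suc zero) = refl

digits : ∀ n → Fin (2 ^ n) → Vec Bool n
digits zero    i = []
digits (suc n) i = unbit (quotient (2 ^ n) i) ∷ digits n (remainder {2} (2 ^ n) i)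

digits∘bin : (a : Vec Bool n) → digits n (bin a) ≡ a
digits∘bin [] = refl
digits∘bin {suc n} (b ∷ a) = trans
  (cong (λ qr → unbit (proj₁ qr) ∷ digits n (proj₂ qr)) (remQuot-combine (bit b) (bin a)))
  (cong₂ _∷_ (unbit∘bit b) (digits∘bin a))

bin∘digits : ∀ n (i : Fin (2 ^ n)) → bin (digits n i) ≡ i
bin∘digits zero    zero = refl
bin∘digits (suc n) i    = trans
  (cong₂ combine (bit∘unbit (quotient (2 ^ n) i)) (bin∘digits n (remainder {2} (2 ^ n) i)))
  (combine-remQuot {2} (2 ^ n) i)

-- Binary encoding turns `f` into an injection from `Fin (2 ^ m)` to `Fin (2 ^ k)`; the pigeonhole
-- principle and strict monotonicity of powers of 2 then rule out `k < m`. This count stands in for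
-- dimension theory over GF(2).
bitInjection⇒≤ : (f : Vec Bool m → Vec Bool k) → (∀ u v → f u ≡ f v → u ≡ v) → m ≤ k
bitInjection⇒≤ {m} {k} f f-inj = ≮⇒≥ λ k<m →
  <⇒≱ (^-monoʳ-< 2 (n<1+n 1) k<m) (injective⇒≤ {f = λ i → bin (f (digits m i))} inj)
  where
  inj : ∀ {i j} → bin (f (digits m i)) ≡ bin (f (digits m j)) → i ≡ j
  inj {i} {j} eq = begin
    i                 ≡⟨ bin∘digits m i ⟨
    bin (digits m i)  ≡⟨ cong bin (f-inj _ _ f-eq) ⟩
    bin (digits m j)  ≡⟨ bin∘digits m j ⟩
    j                 ∎
    where
    open ≡-Reasoning
    f-eq : f (digits m i) ≡ f (digits m j)
    f-eq = trans (sym (digits∘bin _)) (trans (cong (digits k) eq) (digits∘bin _))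

-- Ternary strings

trit : Three → Fin 3
trit 𝟎 = zero
trit 𝐮 = suc zero
trit 𝟏 = suc (suc zero)

untrit : Fin 3 → Three
untrit zero          = 𝟎
untrit (suc zero)    = 𝐮
untrit (suc (suc _)) = 𝟏

trit∘untrit : ∀ i → trit (untrit i) ≡ i
trit∘untrit zero             = refl
trit∘untrit (suc zero)       = refl
trit∘untrit (suc (suc zero)) = refl

index : Vec Three n → Fin (3 ^ n)
index []      = zero
index (x ∷ s) = combine (trit x) (index s)

trits : ∀ n → Fin (3 ^ n) → Vec Three n
trits zero    i = []
trits (suc n) i = untrit (quotient (3 ^ n) i) ∷ trits n (remainder {3} (3 ^ n) i)

index∘trits : ∀ n (i : Fin (3 ^ n)) → index (trits n i) ≡ i
index∘trits zero    zero = refl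
index∘trits (suc n) i    = trans
  (cong₂ combine (trit∘untrit (quotient (3 ^ n) i)) (index∘trits n (remainder {3} (3 ^ n) i)))
  (combine-remQuot {3} (3 ^ n) i)

-- By `index∘trits`, `index` reaches every position, so a bit vector of length `3 ^ n` is faithfully
-- a function on ternary strings.
lookup∘index-injective : (u v : Vec Bool (3 ^ n)) →
  (∀ (s : Vec Three n) → lookup u (index s) ≡ lookup v (index s)) → u ≡ v
lookup∘index-injective {n} u v eq = begin
  u                    ≡⟨ tabulate∘lookup u ⟨
  tabulate (lookup u)  ≡⟨ tabulate-cong lookup≡ ⟩
  tabulate (lookup v)  ≡⟨ tabulate∘lookup v ⟩
  v                    ∎
  where
  open ≡-Reasoning
  lookup≡ : ∀ i → lookup u i ≡ lookup v i
  lookup≡ i = subst (λ j → lookup u j ≡ lookup v j) (index∘trits n i) (eq (trits n i))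

∑ : ∀ n → (Vec Three n → Bool) → Bool
∑ zero    f = f []
∑ (suc n) f = ∑ n (λ t → f (𝟎 ∷ t)) ⊕ ∑ n (λ t → f (𝐮 ∷ t)) ⊕ ∑ n (λ t → f (𝟏 ∷ t))

∑-cong : ∀ n {f g : Vec Three n → Bool} → (∀ t → f t ≡ g t) → ∑ n f ≡ ∑ n g
∑-cong zero    eq = eq []
∑-cong (suc n) eq =
  cong₂ _⊕_ (∑-cong n λ t → eq (𝟎 ∷ t))
            (cong₂ _⊕_ (∑-cong n λ t → eq (𝐮 ∷ t)) (∑-cong n λ t → eq (𝟏 ∷ t)))

∑-xor : ∀ n (f g : Vec Three n → Bool) → ∑ n (λ t → f t ⊕ g t) ≡ ∑ n f ⊕ ∑ n g
∑-xor zero    f g = refl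
∑-xor (suc n) f g
  rewrite ∑-xor n (λ t → f (𝟎 ∷ t)) (λ t → g (𝟎 ∷ t))
        | ∑-xor n (λ t → f (𝐮 ∷ t)) (λ t → g (𝐮 ∷ t))
        | ∑-xor n (λ t → f (𝟏 ∷ t)) (λ t → g (𝟏 ∷ t))
        | ⊕-interchange (∑ n (λ t → f (𝐮 ∷ t))) (∑ n (λ t → g (𝐮 ∷ t)))
                          (∑ n (λ t → f (𝟏 ∷ t))) (∑ n (λ t → g (𝟏 ∷ t)))
  = ⊕-interchange (∑ n (λ t → f (𝟎 ∷ t))) _ _ _

∑-zero : ∀ n → ∑ n (λ _ → false) ≡ false
∑-zero zero    = refl
∑-zero (suc n) rewrite ∑-zero n = refl

∑-scale : ∀ n b (f : Vec Three n → Bool) → ∑ n (λ t → b · f t) ≡ b · ∑ n f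
∑-scale n false f = ∑-zero n
∑-scale n true  f = refl

-- Decompositions into rank-one matrices over GF(2)

rankOneSum : Vec ((X → Bool) × (Y → Bool)) k → X → Y → Bool
rankOneSum []             s t = false
rankOneSum ((r , c) ∷ ps) s t = (r s · c t) ⊕ rankOneSum ps s t

rankOneSum-++ : (ps : Vec ((X → Bool) × (Y → Bool)) k) (qs : Vec ((X → Bool) × (Y → Bool)) l) →
  ∀ s t → rankOneSum (ps ++ qs) s t ≡ rankOneSum ps s t ⊕ rankOneSum qs s t
rankOneSum-++ []             qs s t = refl
rankOneSum-++ ((r , c) ∷ ps) qs s t =
  trans (cong ((r s · c t) ⊕_) (rankOneSum-++ ps qs s t)) (sym (xor-assoc (r s · c t) _ _))

RankAtMost : (X → Y → Bool) → ℕ → Set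
RankAtMost {X} {Y} A k =
  Σ (Vec ((X → Bool) × (Y → Bool)) k) λ ps → ∀ s t → A s t ≡ rankOneSum ps s t

rank-cong : {A B : X → Y → Bool} → (∀ s t → A s t ≡ B s t) → RankAtMost B k → RankAtMost A k
rank-cong A≡B (ps , eq) = ps , λ s t → trans (A≡B s t) (eq s t)

rank-xor : {A B : X → Y → Bool} → RankAtMost A k → RankAtMost B l →
           RankAtMost (λ s t → A s t ⊕ B s t) (k + l)
rank-xor (ps , eqA) (qs , eqB) =
  ps ++ qs , λ s t → trans (cong₂ _⊕_ (eqA s t) (eqB s t)) (sym (rankOneSum-++ ps qs s t))

rank-zero : RankAtMost {X} {Y} (λ _ _ → false) 0
rank-zero = [] , λ _ _ → refl

rank-one : (r : X → Bool) (c : Y → Bool) → RankAtMost (λ s t → r s · c t) 1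
rank-one r c = (r , c) ∷ [] , λ s t → sym (xor-identityʳ (r s · c t))

apply : (X → Vec Three n → Bool) → (Vec Three n → Bool) → X → Bool
apply {n = n} A v s = ∑ n λ t → A s t · v t

-- A product A v with A = ∑ rᵢ ⊗ cᵢ only depends on the k bits cᵢ · v.
measure : Vec ((X → Bool) × (Vec Three n → Bool)) k → (Vec Three n → Bool) → Vec Bool k
measure {n = n} ps v = map (λ p → ∑ n λ t → proj₂ p t · v t) ps

apply-factors : (ps : Vec ((X → Bool) × (Vec Three n → Bool)) k) (v w : Vec Three n → Bool) →
  measure ps v ≡ measure ps w → ∀ s → apply (rankOneSum ps) v s ≡ apply (rankOneSum ps) w s
apply-factors [] v w eq s = refl
apply-factors {n = n} ((r , c) ∷ ps) v w eq s = begin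
  apply (rankOneSum ((r , c) ∷ ps)) v s
    ≡⟨ expand v ⟩
  r s · ∑ n (λ t → c t · v t) ⊕ apply (rankOneSum ps) v s
    ≡⟨ cong₂ (λ b d → r s · b ⊕ d) (∷-injectiveˡ eq) (apply-factors ps v w (∷-injectiveʳ eq) s) ⟩
  r s · ∑ n (λ t → c t · w t) ⊕ apply (rankOneSum ps) w s
    ≡⟨ expand w ⟨
  apply (rankOneSum ((r , c) ∷ ps)) w s ∎
  where
  open ≡-Reasoning
  expand : ∀ v → apply (rankOneSum ((r , c) ∷ ps)) v s ≡
                 r s · ∑ n (λ t → c t · v t) ⊕ apply (rankOneSum ps) v s
  expand v = begin
    ∑ n (λ t → ((r s · c t) ⊕ rankOneSum ps s t) · v t)
      ≡⟨ ∑-cong n (λ t → trans (∧-distribʳ-xor (v t) (r s · c t) (rankOneSum ps s t))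
                               (cong (_⊕ (rankOneSum ps s t · v t)) (∧-assoc (r s) (c t) (v t)))) ⟩
    ∑ n (λ t → (r s · c t · v t) ⊕ (rankOneSum ps s t · v t))
      ≡⟨ ∑-xor n _ _ ⟩
    ∑ n (λ t → r s · c t · v t) ⊕ apply (rankOneSum ps) v s
      ≡⟨ cong (_⊕ apply (rankOneSum ps) v s) (∑-scale n (r s) _) ⟩
    r s · ∑ n (λ t → c t · v t) ⊕ apply (rankOneSum ps) v s ∎

Nonsingular : (X → Vec Three n → Bool) → Set
Nonsingular A = ∀ v w → (∀ s → apply A v s ≡ apply A w s) → ∀ t → v t ≡ w t

-- The `k` bits of `measure ps v` determine `A v`, and `A v` determines `v`. Hence `3 ^ n` bits
-- inject into `k` bits.
nonsingular⇒fullRank : {A : X → Vec Three n → Bool} → Nonsingular A → RankAtMost A k → 3 ^ n ≤ k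
nonsingular⇒fullRank {n = n} {A = A} A-inj (ps , A≡) =
  bitInjection⇒≤ (λ u → measure ps (entries u)) λ u v eq →
    lookup∘index-injective u v (A-inj (entries u) (entries v) λ s → begin
      apply A (entries u) s                ≡⟨ ∑-cong n (λ t → cong (_· entries u t) (A≡ s t)) ⟩
      apply (rankOneSum ps) (entries u) s  ≡⟨ apply-factors ps _ _ eq s ⟩
      apply (rankOneSum ps) (entries v) s  ≡⟨ ∑-cong n (λ t → cong (_· entries v t) (A≡ s t)) ⟨
      apply A (entries v) s                ∎)
  where
  open ≡-Reasoning
  entries : Vec Bool (3 ^ n) → Vec Three n → Bool
  entries u t = lookup u (index t)

-- The incidence matrix of subcubes

compatible : Three → Three → Bool
compatible 𝟎 𝟏 = false
compatible 𝟏 𝟎 = false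
compatible _ _ = true

meets : Vec Three n → Vec Three n → Bool
meets []      []      = true
meets (x ∷ s) (y ∷ t) = compatible x y · meets s t

-- The coefficients are the rows of the inverse of the 3 × 3 matrix compatible;
-- the summand false stands for a zero entry of that matrix.
recover𝟎 : ∀ a b c → ((false ⊕ b ⊕ c) ⊕ (a ⊕ b ⊕ c)) ≡ a
recover𝟎 = solve 3 (λ a b c → (con false :+ (b :+ c)) :+ (a :+ (b :+ c)) := a) refl

recover𝟏 : ∀ a b c → ((a ⊕ b ⊕ false) ⊕ (a ⊕ b ⊕ c)) ≡ c
recover𝟏 = solve 3 (λ a b c → (a :+ (b :+ con false)) :+ (a :+ (b :+ c)) := c) refl

recover𝐮 : ∀ a b c → ((a ⊕ b ⊕ false) ⊕ (false ⊕ b ⊕ c)) ⊕ (a ⊕ b ⊕ c) ≡ b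
recover𝐮 = solve 3 (λ a b c → ((a :+ (b :+ con false)) :+ (con false :+ (b :+ c))) :+ (a :+ (b :+ c)) := b) refl

-- By the tensor structure, the product at row `x ∷ s` is a combination of the products of the
-- smaller matrix with the three slices `v (y ∷ _)`, with coefficients from row `x` of `compatible`.
-- Inverting that 3 × 3 matrix isolates the product for each slice, and induction recovers the
-- slice.
meets-nonsingular : ∀ n → Nonsingular (meets {n})
meets-nonsingular zero    v w eq [] = eq []
meets-nonsingular (suc n) v w eq = λ where
    (𝟎 ∷ t) → meets-nonsingular n _ _ combine𝟎 t
    (𝐮 ∷ t) → meets-nonsingular n _ _ combine𝐮 t
    (𝟏 ∷ t) → meets-nonsingular n _ _ combine𝟏 t
  where
  slice : (Vec Three (suc n) → Bool) → Three → Vec Three n → Bool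
  slice v x s = apply meets (λ t → v (x ∷ t)) s

  -- Evaluation leaves a sum of `false` where `compatible` has a zero entry; `∑-zero` collapses it
  -- on both sides at once.
  row𝟎 : ∀ s → slice v 𝟎 s ⊕ slice v 𝐮 s ⊕ false ≡ slice w 𝟎 s ⊕ slice w 𝐮 s ⊕ false
  row𝟎 s = subst (λ b → slice v 𝟎 s ⊕ slice v 𝐮 s ⊕ b ≡ slice w 𝟎 s ⊕ slice w 𝐮 s ⊕ b)
                 (∑-zero n) (eq (𝟎 ∷ s))

  row𝟏 : ∀ s → false ⊕ slice v 𝐮 s ⊕ slice v 𝟏 s ≡ false ⊕ slice w 𝐮 s ⊕ slice w 𝟏 s
  row𝟏 s = subst (λ b → b ⊕ slice v 𝐮 s ⊕ slice v 𝟏 s ≡ b ⊕ slice w 𝐮 s ⊕ slice w 𝟏 s)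
                 (∑-zero n) (eq (𝟏 ∷ s))

  row𝐮 : ∀ s → slice v 𝟎 s ⊕ slice v 𝐮 s ⊕ slice v 𝟏 s ≡ slice w 𝟎 s ⊕ slice w 𝐮 s ⊕ slice w 𝟏 s
  row𝐮 s = eq (𝐮 ∷ s)

  combine𝟎 : ∀ s → slice v 𝟎 s ≡ slice w 𝟎 s
  combine𝟎 s = trans (sym (recover𝟎 _ (slice v 𝐮 s) (slice v 𝟏 s)))
    (trans (cong₂ _⊕_ (row𝟏 s) (row𝐮 s)) (recover𝟎 _ (slice w 𝐮 s) (slice w 𝟏 s)))

  combine𝟏 : ∀ s → slice v 𝟏 s ≡ slice w 𝟏 s
  combine𝟏 s = trans (sym (recover𝟏 (slice v 𝟎 s) (slice v 𝐮 s) _))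
    (trans (cong₂ _⊕_ (row𝟎 s) (row𝐮 s)) (recover𝟏 (slice w 𝟎 s) (slice w 𝐮 s) _))

  combine𝐮 : ∀ s → slice v 𝐮 s ≡ slice w 𝐮 s
  combine𝐮 s = trans (sym (recover𝐮 (slice v 𝟎 s) _ (slice v 𝟏 s)))
    (trans (cong₂ _⊕_ (cong₂ _⊕_ (row𝟎 s) (row𝟏 s)) (row𝐮 s))
           (recover𝐮 (slice w 𝟎 s) _ (slice w 𝟏 s)))

meets-common : (s t : Vec Three n) (a : Vec Bool n) →
  meets s (map embed a) ≡ true → meets t (map embed a) ≡ true → meets s t ≡ true
meets-common []      []      []          _ _ = refl
meets-common (𝐮 ∷ s) (𝐮 ∷ t) (_     ∷ a) p q = meets-common s t a p q
meets-common (𝟎 ∷ s) (𝟎 ∷ t) (false ∷ a) p q = meets-common s t a p q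
meets-common (𝟎 ∷ s) (𝐮 ∷ t) (false ∷ a) p q = meets-common s t a p q
meets-common (𝐮 ∷ s) (𝟎 ∷ t) (false ∷ a) p q = meets-common s t a p q
meets-common (𝐮 ∷ s) (𝟏 ∷ t) (true  ∷ a) p q = meets-common s t a p q
meets-common (𝟏 ∷ s) (𝐮 ∷ t) (true  ∷ a) p q = meets-common s t a p q
meets-common (𝟏 ∷ s) (𝟏 ∷ t) (true  ∷ a) p q = meets-common s t a p q

incompatible⇒disjoint : (s t : Vec Three n) (j : Fin n) →
  compatible (lookup s j) (lookup t j) ≡ false → meets s t ≡ false
incompatible⇒disjoint (x ∷ s) (y ∷ t) zero    p rewrite p = refl
incompatible⇒disjoint (x ∷ s) (y ∷ t) (suc j) p
  rewrite incompatible⇒disjoint s t j p = ∧-zeroʳ (compatible x y)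

resolution⇒meets : (s : Vec Three n) (a : Vec Bool n) →
                   IsResolution s a → meets s (map embed a) ≡ true
resolution⇒meets []      []      h = refl
resolution⇒meets (x ∷ s) (b ∷ a) h
  rewrite resolution⇒meets s a (λ i → h (suc i)) = trans (∧-identityʳ _) (head x b (h zero))
  where
  head : ∀ x b → (x ≢ 𝐮 → embed b ≡ x) → compatible x (embed b) ≡ true
  head 𝟎 false _ = refl
  head 𝟎 true  h = contradiction (h λ ()) λ ()
  head 𝐮 _     _ = refl
  head 𝟏 false h = contradiction (h λ ()) λ ()
  head 𝟏 true  _ = refl

-- Hazard-free extensions

embed-injective : ∀ {b c} → embed b ≡ embed c → b ≡ c
embed-injective {false} {false} _ = refl
embed-injective {true}  {true}  _ = refl

-- Sending `𝐮` to `false` is an arbitrary choice: only the existence of a resolution matters.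
resolve : Vec Three m → Vec Bool m
resolve = map (λ x → does (x ≟ 𝟏))

resolve-isResolution : (α : Vec Three m) → IsResolution α (resolve α)
resolve-isResolution α i α≢𝐮 rewrite lookup-map i (λ x → does (x ≟ 𝟏)) α with lookup α i
... | 𝟎 = refl
... | 𝐮 = contradiction refl α≢𝐮
... | 𝟏 = refl

hazardFreeExtension-constant : (f : Vec Bool m → Bool) (α : Vec Three m) → ∀ c →
  ConstantOnResolutions f α c → hazardFreeExtension f α ≡ embed c
hazardFreeExtension-constant f α false h
  rewrite dec-true (constantOnResolutions? f α false) h = refl
hazardFreeExtension-constant f α true h
  -- The test for `false` comes first and must fail: `f` is `true` at the resolution `resolve α`.
  rewrite dec-false (constantOnResolutions? f α false) (λ h₀ →
            contradiction (trans (sym (h₀ (resolve α) (resolve-isResolution α)))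
                                 (h (resolve α) (resolve-isResolution α))) λ ())
        | dec-true (constantOnResolutions? f α true) h = refl

isResolution-++ : (α : Vec Three m) (β : Vec Three n) (a : Vec Bool m) (b : Vec Bool n) →
  IsResolution (α ++ β) (a ++ b) → IsResolution α a × IsResolution β b
isResolution-++ {m} {n} α β a b h =
    (λ i → subst₂ (λ x y → x ≢ 𝐮 → embed y ≡ x) (lookup-++ˡ α β i) (lookup-++ˡ a b i) (h (i ↑ˡ n)))
  , (λ i → subst₂ (λ x y → x ≢ 𝐮 → embed y ≡ x) (lookup-++ʳ α β i) (lookup-++ʳ a b i) (h (m ↑ʳ i)))

cell : Three → Vec Three n → Fin (2 ^ n) → Three
cell x s i = if meets s (map embed (digits _ i)) then x else 𝐮

-- The minterm of s is cubeInput 𝟏 s, its maxterm is cubeInput 𝟎 s.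
cubeInput : Three → Vec Three n → Vec Three (n + 2 ^ n)
cubeInput x s = s ++ tabulate (cell x s)

-- In any resolution the selector bits form a point of the cube `s`, so the addressed cell is one of
-- those carrying the definite value `embed c`.
cubeInput-constant : ∀ c (s : Vec Three n) → ConstantOnResolutions (MUX n) (cubeInput (embed c) s) c
cubeInput-constant {n} c s v h = embed-injective (trans (hβ i i-definite) i-value)
  where
  i : Fin (2 ^ n)
  i = bin (take n v)

  parts : IsResolution s (take n v) × IsResolution (tabulate (cell (embed c) s)) (drop n v)
  parts = isResolution-++ s (tabulate (cell (embed c) s)) (take n v) (drop n v)
            (subst (IsResolution (cubeInput (embed c) s)) (sym (take++drop≡id n v)) h)
  hβ = proj₂ parts

  i-value : lookup (tabulate (cell (embed c) s)) i ≡ embed c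
  i-value = trans (lookup∘tabulate (cell (embed c) s) i)
    (cong (λ b → if b then embed c else 𝐮)
      (trans (cong (λ a → meets s (map embed a)) (digits∘bin (take n v)))
             (resolution⇒meets s (take n v) (proj₁ parts))))

  embed≢𝐮 : ∀ c → embed c ≢ 𝐮
  embed≢𝐮 false ()
  embed≢𝐮 true  ()

  i-definite : lookup (tabulate (cell (embed c) s)) i ≢ 𝐮
  i-definite eq = embed≢𝐮 c (trans (sym i-value) eq)

-- Literals separating minterms from maxterms

↑-view : ∀ m {n} (i : Fin (m + n)) → (∃ λ j → j ↑ˡ n ≡ i) ⊎ (∃ λ j → m ↑ʳ j ≡ i)
↑-view m i with splitAt m i in eq
... | inj₁ j = inj₁ (j , splitAt⁻¹-↑ˡ eq)
... | inj₂ j = inj₂ (j , splitAt⁻¹-↑ʳ eq)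

∼-injective : ∀ {x y} → ∼ x ≡ ∼ y → x ≡ y
∼-injective {𝟎} {𝟎} _ = refl
∼-injective {𝐮} {𝐮} _ = refl
∼-injective {𝟏} {𝟏} _ = refl

-- The bit `b` depends on the literal alone, so `M` is constant on any rectangle of pairs that a
-- single literal separates.
DeterminedBySeparation : (X → Vec Three m) → (Y → Vec Three m) → (X → Y → Bool) →
                         Literal m → Bool → Set
DeterminedBySeparation α β M l b =
  ∀ s t → evalLiteral l (α s) ≡ 𝟏 → evalLiteral l (β t) ≡ 𝟎 → M s t ≡ b

-- A selector literal separates only if `s` and `t` carry opposite definite values at that
-- coordinate, so the cubes are disjoint. A positive data literal separates only if its cell is
-- definite in both inputs, so its address lies in both cubes.
meets-determined : ∀ (l : Literal (n + 2 ^ n)) →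
  ∃ (DeterminedBySeparation (cubeInput 𝟏) (cubeInput 𝟎) (meets {n}) l)
meets-determined {n} (pos i) with ↑-view n i
... | inj₁ (j , refl) = false , λ s t p q → incompatible⇒disjoint s t j
        (cong₂ compatible (trans (sym (lookup-++ˡ s _ j)) p) (trans (sym (lookup-++ˡ t _ j)) q))
... | inj₂ (j , refl) = true , λ s t p q → meets-common s t (digits n j)
        (inCube 𝟏 (λ ()) s p) (inCube 𝟎 (λ ()) t q)
  where
  inCube : ∀ x → x ≢ 𝐮 → (s : Vec Three n) → lookup (cubeInput x s) (n ↑ʳ j) ≡ x →
           meets s (map embed (digits n j)) ≡ true
  inCube x x≢𝐮 s p
    with meets s (map embed (digits n j))
       | trans (sym (trans (lookup-++ʳ s _ j) (lookup∘tabulate (cell x s) j))) p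
  ... | true  | _  = refl
  ... | false | eq = contradiction (sym eq) x≢𝐮
meets-determined {n} (neg i) with ↑-view n i
... | inj₁ (j , refl) = false , λ s t p q → incompatible⇒disjoint s t j
        (cong₂ compatible (∼-injective {y = 𝟎} (trans (cong ∼_ (sym (lookup-++ˡ s _ j))) p))
                          (∼-injective {y = 𝟏} (trans (cong ∼_ (sym (lookup-++ˡ t _ j))) q)))
-- The bit `true` is arbitrary here: minterm cells are `𝟏` or `𝐮`, so a negated data literal is
-- never `𝟏` on a minterm.
... | inj₂ (j , refl) = true , λ s t p q →
        contradiction (trans (sym (trans (lookup-++ʳ s _ j) (lookup∘tabulate (cell 𝟏 s) j)))
                             (∼-injective {y = 𝟎} p))
                      (cell≢𝟎 s)
  where
  cell≢𝟎 : (s : Vec Three n) → cell 𝟏 s j ≢ 𝟎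
  cell≢𝟎 s eq with meets s (map embed (digits n j))
  cell≢𝟎 s () | true
  cell≢𝟎 s () | false

-- From formulas to rank decompositions

⊓-one : ∀ {x y} → x ⊓ y ≡ 𝟏 → x ≡ 𝟏 × y ≡ 𝟏
⊓-one {𝟏} {𝟏} _ = refl , refl
⊓-one {𝐮} {𝟎} ()
⊓-one {𝐮} {𝐮} ()
⊓-one {𝐮} {𝟏} ()

⊔-zero : ∀ {x y} → x ⊔ y ≡ 𝟎 → x ≡ 𝟎 × y ≡ 𝟎
⊔-zero {𝟎} {𝟎} _ = refl , refl
⊔-zero {𝐮} {𝟎} ()
⊔-zero {𝐮} {𝐮} ()
⊔-zero {𝐮} {𝟏} ()

⊓-zeroʳ : ∀ x {y} → x ⊓ y ≡ 𝟎 → not (does (x ≟ 𝟎)) ≡ true → y ≡ 𝟎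
⊓-zeroʳ 𝐮 {𝟎} _ _ = refl
⊓-zeroʳ 𝟏     p _ = p

⊔-oneʳ : ∀ x {y} → x ⊔ y ≡ 𝟏 → not (does (x ≟ 𝟏)) ≡ true → y ≡ 𝟏
⊔-oneʳ 𝐮 {𝟏} _ _ = refl
⊔-oneʳ 𝟎     p _ = p

≟-sound : ∀ x y → does (x ≟ y) ≡ true → x ≡ y
≟-sound 𝟎 𝟎 _ = refl
≟-sound 𝐮 𝐮 _ = refl
≟-sound 𝟏 𝟏 _ = refl

·-true : ∀ {a b} → a · b ≡ true → a ≡ true × b ≡ true
·-true {true} {true} _ = refl , refl

-- Selects `M` or its complement, so that both are treated by one argument.
shade : Bool → Bool → Bool
shade b x = if b then x else not x

restrict : (X → Bool) → (Y → Bool) → (X → Y → Bool) → X → Y → Bool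
restrict r c A s t = (r s · c t) · A s t

-- `p true` bounds the rank of `M` on the rectangle `r` × `c`, and `p false` that of its complement
-- there. Both matrices are set to zero outside the rectangle.
RectangleRanks : (X → Bool) → (Y → Bool) → (X → Y → Bool) → ℕ → Set
RectangleRanks r c M k = Σ (Bool → ℕ) λ p → p true + p false ≡ k ×
  (∀ b → RankAtMost (restrict r c λ s t → shade b (M s t)) (p b))

-- The hypothesis writes the indicator of the rectangle as a GF(2) sum of two others; restriction
-- distributes over this sum and rank is subadditive.
ranks-merge : {r r₁ r₂ : X → Bool} {c c₁ c₂ : Y → Bool} {M : X → Y → Bool} →
  (∀ s t → r s · c t ≡ (r₁ s · c₁ t) ⊕ (r₂ s · c₂ t)) →
  RectangleRanks r₁ c₁ M k → RectangleRanks r₂ c₂ M l → RectangleRanks r c M (k + l)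
ranks-merge {r₁ = r₁} {r₂} {c₁ = c₁} {c₂} {M} split (p₁ , refl , R₁) (p₂ , refl , R₂) =
    (λ b → p₁ b + p₂ b)
  , interchange +-commutativeSemigroup (p₁ true) (p₂ true) (p₁ false) (p₂ false)
  , λ b → rank-cong (λ s t → trans (cong (_· shade b (M s t)) (split s t))
                                   (∧-distribʳ-xor (shade b (M s t)) (r₁ s · c₁ t) (r₂ s · c₂ t)))
                    (rank-xor (R₁ b) (R₂ b))

-- On a monochromatic rectangle one of the two restrictions is the rectangle itself, of rank at most
-- one, and the other is zero.
ranks-constant : (r : X → Bool) (c : Y → Bool) {M : X → Y → Bool} → ∀ d →
  (∀ s t → r s ≡ true → c t ≡ true → M s t ≡ d) → RectangleRanks r c M 1
ranks-constant r c {M} d M≡d = (λ b → if shade d b then 1 else 0) , total d , λ b →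
  rank-cong (λ s t → value (r s) (c t) b (M≡d s t)) (rank (shade d b))
  where
  total : ∀ d → (if shade d true then 1 else 0) + (if shade d false then 1 else 0) ≡ 1
  total true  = refl
  total false = refl

  shade-comm : ∀ b d → shade b d ≡ shade d b
  shade-comm true  true  = refl
  shade-comm true  false = refl
  shade-comm false true  = refl
  shade-comm false false = refl

  value : ∀ x y b {z} → (x ≡ true → y ≡ true → z ≡ d) →
          (x · y) · shade b z ≡ (x · y) · shade d b
  value false y     b z≡d = refl
  value true  false b z≡d = refl
  value true  true  b z≡d = trans (cong (shade b) (z≡d refl refl)) (shade-comm b d)

  rank : ∀ e → RankAtMost (λ s t → (r s · c t) · e) (if e then 1 else 0)
  rank true  = rank-cong (λ s t → ∧-identityʳ (r s · c t)) (rank-one r c)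
  rank false = rank-cong (λ s t → ∧-zeroʳ (r s · c t)) rank-zero

-- The Karchmer-Wigderson protocol: `F` stays `𝟏` on the rows and `𝟎` on the columns of the current
-- rectangle. A minimum is `𝟎` only if an argument is, so `∧` splits the columns by whether `G` is
-- already `𝟎`; dually, `∨` splits the rows. With `𝐮` present, the part not given to `G` still has
-- the needed definite value at `H`.
formula⇒ranks : (α : X → Vec Three m) (β : Y → Vec Three m) {M : X → Y → Bool} →
  (∀ l → ∃ (DeterminedBySeparation α β M l)) →
  ∀ F (r : X → Bool) (c : Y → Bool) →
  (∀ s → r s ≡ true → eval F (α s) ≡ 𝟏) → (∀ t → c t ≡ true → eval F (β t) ≡ 𝟎) →
  RectangleRanks r c M (leaves F)
formula⇒ranks α β det (leaf l) r c F-one F-zero = ranks-constant r c (proj₁ (det l))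
  λ s t rs ct → proj₂ (det l) s t (F-one s rs) (F-zero t ct)
formula⇒ranks α β det (G ∧ H) r c F-one F-zero = ranks-merge {r = r} {r} {r} {c}
  (λ s t → split (r s) (c t) (G-zero t))
  (formula⇒ranks α β det G r (λ t → c t · G-zero t)
    (λ s rs → proj₁ (⊓-one (F-one s rs)))
    (λ t ct → ≟-sound _ 𝟎 (proj₂ (·-true ct))))
  (formula⇒ranks α β det H r (λ t → c t · not (G-zero t))
    (λ s rs → proj₂ (⊓-one {eval G (α s)} (F-one s rs)))
    (λ t ct → ⊓-zeroʳ (eval G (β t)) (F-zero t (proj₁ (·-true ct))) (proj₂ (·-true {c t} ct))))
  where
  G-zero = λ t → does (eval G (β t) ≟ 𝟎)
  split : ∀ x y z → x · y ≡ (x · y · z) ⊕ (x · y · not z)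
  split false y     z     = refl
  split true  false z     = refl
  split true  true  false = refl
  split true  true  true  = refl
formula⇒ranks α β det (G ∨ H) r c F-one F-zero = ranks-merge {r = r} {c = c} {c} {c}
  (λ s t → split (r s) (c t) (G-one s))
  (formula⇒ranks α β det G (λ s → r s · G-one s) c
    (λ s rs → ≟-sound _ 𝟏 (proj₂ (·-true rs)))
    (λ t ct → proj₁ (⊔-zero (F-zero t ct))))
  (formula⇒ranks α β det H (λ s → r s · not (G-one s)) c
    (λ s rs → ⊔-oneʳ (eval G (α s)) (F-one s (proj₁ (·-true rs))) (proj₂ (·-true {r s} rs)))
    (λ t ct → proj₂ (⊔-zero {eval G (β t)} (F-zero t ct))))
  where
  G-one = λ s → does (eval G (α s) ≟ 𝟏)
  split : ∀ x y z → x · y ≡ ((x · z) · y) ⊕ ((x · not z) · y)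
  split false y z     = refl
  split true  y false = refl
  split true  y true  = sym (xor-identityʳ y)

theorem5p13 : ∀ (n : ℕ) → 1 ≤ n → (F : Formula (n + 2 ^ n)) →
    IsHazardFreeFor F (MUX n) → 2 * 3 ^ n ∸ 1 ≤ leaves F
theorem5p13 n _ F (_ , F≡) = m≤n+o⇒m∸n≤o (2 * 3 ^ n) 1 bound
  where
  onCube : ∀ c (s : Vec Three n) → eval F (cubeInput (embed c) s) ≡ embed c
  onCube c s = trans (F≡ (cubeInput (embed c) s))
    (hazardFreeExtension-constant (MUX n) (cubeInput (embed c) s) c (cubeInput-constant c s))

  bound : 2 * 3 ^ n ≤ 1 + leaves F
  bound with p , total , ranks ← formula⇒ranks (cubeInput 𝟏) (cubeInput 𝟎) {meets} meets-determined
               F (λ _ → true) (λ _ → true) (λ s _ → onCube true s) (λ t _ → onCube false t) = begin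
    3 ^ n + (3 ^ n + 0)     ≡⟨ cong (3 ^ n +_) (+-identityʳ (3 ^ n)) ⟩
    3 ^ n + 3 ^ n           ≤⟨ +-mono-≤ (fullRank (ranks true)) (fullRank complement) ⟩
    p true + (1 + p false)  ≡⟨ +-suc (p true) (p false) ⟩
    1 + (p true + p false)  ≡⟨ cong suc total ⟩
    1 + leaves F            ∎
    where
    open ≤-Reasoning
    fullRank : RankAtMost (meets {n}) k → 3 ^ n ≤ k
    fullRank = nonsingular⇒fullRank (meets-nonsingular n)
    -- Adding the all-ones matrix negates every entry, so its sum with `not (meets s t)` evaluates
    -- to a double negation.
    complement : RankAtMost (meets {n}) (1 + p false)
    complement = rank-cong (λ s t → sym (not-involutive (meets s t)))
      (rank-xor (rank-one (λ _ → true) (λ _ → true)) (ranks false))
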